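{- Let $G$ be a connected unit interval graph on $n\geq 2$ vertices. Let $v_1,\dots,v_n$ be the vertices of $G$ indexed by increasing starting dates. Then the following propositions are equivalent: \begin{enumerate} \item $G$ has outcome $\mathcal{D}$; \item $G$ has a $\{K_2,K_3\}$-factor; \item $G$ has a pairing dominating set; \item $n$ is even or some vertex $v_{2i}$ (with $1\le 2i\le n$) is not a cut-vertex of $G$. \end{enumerate}
   Context: All graphs are finite and simple; $N[v]$ denotes the closed neighborhood of $v$. A unit interval graph is the intersection graph of a family of closed intervals of the real line all of length $1$ (vertices are intervals, adjacent if and only if they intersect); such a representation is fixed, and the starting date of a vertex is the left endpoint of its interval. A cut-vertex is a vertex whose removal disconnects the graph. For a family $\mathcal{F}$ of graphs, an $\mathcal{F}$-factor of $G$ is a spanning subgraph $H$ of $G$ (same vertex set) such that each connected component of $H$ is isomorphic to some graph in $\mathcal{F}$. A pairing dominating set of $G=(V,E)$ is a set of pairs of vertices $\{(u_1,v_1),\dots,(u_k,v_k)\}$ such that all the vertices appearing in the pairs are distinct and $V=\bigcup_{i=1}^k \left(N[u_i]\cap N[v_i]\right)$. The Maker-Breaker domination game on a graph $G$: two players, Dominator and Staller, alternately claim a not-yet-claimed vertex of $G$. Dominator wins if at some point the vertices she has claimed form a dominating set of $G$. Otherwise, i.e. if Staller manages to claim a vertex and all its neighbors, Staller wins. The graph $G$ has outcome $\mathcal{D}$ if Dominator has a winning strategy whoever starts (equivalently, if Dominator has a winning strategy when playing second, since no player benefits from skipping a turn). -}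

module Defs where

open import Level using (0ℓ)
open import Data.Nat as ℕ using (ℕ; suc)
open import Data.Nat.Divisibility using (_∣_)
open import Data.Fin as Fin using (Fin; toℕ)
open import Data.Fin.Subset using (Subset; _∈_; _∉_; _∪_; ⁅_⁆; ⊥)
open import Data.Rational as ℚ using (ℚ; 0ℚ; 1ℚ)
import Data.Rational.Properties as ℚ
open import Data.Rational.Solver using (module +-*-Solver)
open import Data.List using (List; []; _∷_; concatMap)
open import Data.List.Relation.Unary.Any using (Any)
open import Data.List.Relation.Unary.Unique.Propositional using (Unique)
open import Data.Product using (∃; ∃-syntax; Σ-syntax; _×_; _,_)
open import Data.Sum using (_⊎_)
open import Function.Bundles using (_⇔_)
open import Function.Definitions using (Injective)
open import Relation.Binary.Core using (Rel)
open import Relation.Binary.Definitions using (Irreflexive; Symmetric; Decidable)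
open import Relation.Binary.Construct.Closure.ReflexiveTransitive using (Star)
open import Relation.Binary.PropositionalEquality
  using (_≡_; _≢_; refl; sym; subst; ≢-sym)
open import Relation.Nullary using (¬_; ¬?)
open import Relation.Unary using (Pred)

private
  variable
    n k : ℕ

-- The real line: Cauchy sequences of rationals.  Equality of reals is
-- never used, so no quotient or setoid is needed.

record ℝ : Set where
  field
    seq    : ℕ → ℚ
    cauchy : ∀ ε → 0ℚ ℚ.< ε →
             ∃[ N ] ∀ i j → N ℕ.≤ i → N ℕ.≤ j → ℚ.∣ seq i ℚ.- seq j ∣ ℚ.≤ ε
open ℝ

-- The order on the represented reals, i.e. lim (x - y) ≤ 0, rather than
-- a termwise comparison of the sequences.

infix 4 _≤ℝ_

_≤ℝ_ : ℝ → ℝ → Set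
x ≤ℝ y = ∀ ε → 0ℚ ℚ.< ε → ∃[ N ] ∀ i → N ℕ.≤ i → seq x i ℚ.≤ seq y i ℚ.+ ε

infixl 6 _+ℚ_

_+ℚ_ : ℝ → ℚ → ℝ
seq    (x +ℚ q) i = seq x i ℚ.+ q
cauchy (x +ℚ q) ε ε>0 with cauchy x ε ε>0
... | N , close = N , λ i j N≤i N≤j →
  subst (λ d → ℚ.∣ d ∣ ℚ.≤ ε) (sym (shift (seq x i) (seq x j) q)) (close i j N≤i N≤j)
  where
  shift : ∀ a b c → (a ℚ.+ c) ℚ.- (b ℚ.+ c) ≡ a ℚ.- b
  shift = solve 3 (λ a b c → (a :+ c) :- (b :+ c) := a :- b) refl
    where open +-*-Solver

-- A closed interval of length 1 is given by its left endpoint a.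

infix 4 _∈[_,+1]

_∈[_,+1] : ℝ → ℝ → Set
t ∈[ a ,+1] = a ≤ℝ t × t ≤ℝ a +ℚ 1ℚ

UnitIntervalsIntersect : ℝ → ℝ → Set
UnitIntervalsIntersect a b = ∃[ t ] t ∈[ a ,+1] × t ∈[ b ,+1]

record Graph (n : ℕ) : Set₁ where
  field
    Adj    : Rel (Fin n) 0ℓ
    irrefl : Irreflexive _≡_ Adj
    symm   : Symmetric Adj
    adj?   : Decidable Adj
open Graph public

IsUnitIntervalRepresentation : Graph n → (Fin n → ℝ) → Set
IsUnitIntervalRepresentation G start =
  ∀ u v → u ≢ v → Adj G u v ⇔ UnitIntervalsIntersect (start u) (start v)

IncreasingStartingDates : (Fin n → ℝ) → Set
IncreasingStartingDates start = ∀ i j → i Fin.≤ j → start i ≤ℝ start j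

_N[_] : Graph n → Fin n → Pred (Fin n) 0ℓ
(G N[ v ]) w = w ≡ v ⊎ Adj G v w

Reachable : Graph n → Rel (Fin n) 0ℓ
Reachable G = Star (Adj G)

Connected : Graph n → Set
Connected G = ∀ u v → Reachable G u v

ConnectedWithout : Graph n → Fin n → Set
ConnectedWithout G v =
  ∀ a b → a ≢ v → b ≢ v → Star (λ x y → Adj G x y × x ≢ v × y ≢ v) a b

CutVertex : Graph n → Fin n → Set
CutVertex G v = ¬ ConnectedWithout G v

K : ∀ n → Graph n
Adj    (K n)         = _≢_
irrefl (K n) i≡j i≢j = i≢j i≡j
symm   (K n)         = ≢-sym
adj?   (K n) i j     = ¬? (i Fin.≟ j)

-- An isomorphism from F onto the connected component of H containing v.

record ComponentIso (H : Graph n) (v : Fin n) (F : Graph k) : Set where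
  field
    embed     : Fin k → Fin n
    injective : Injective _≡_ _≡_ embed
    image     : ∀ u → Reachable H v u ⇔ (∃[ i ] embed i ≡ u)
    adjacency : ∀ i j → Adj F i j ⇔ Adj H (embed i) (embed j)

GraphFamily : Set₂
GraphFamily = Pred (∃ Graph) (Level.suc 0ℓ)

⟨K₂,K₃⟩ : GraphFamily
⟨K₂,K₃⟩ F = F ≡ (2 , K 2) ⊎ F ≡ (3 , K 3)

record HasFactor (𝓕 : GraphFamily) (G : Graph n) : Set₁ where
  field
    factor     : Graph n
    subgraph   : ∀ u v → Adj factor u v → Adj G u v
    components : ∀ v → ∃[ k ] Σ[ F ∈ Graph k ] 𝓕 (k , F) × ComponentIso factor v F

HasPairingDominatingSet : Graph n → Set
HasPairingDominatingSet {n} G = Σ[ pairs ∈ List (Fin n × Fin n) ]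
  Unique (concatMap (λ (u , v) → u ∷ v ∷ []) pairs)
  × (∀ w → Any (λ (u , v) → (G N[ u ]) w × (G N[ v ]) w) pairs)

Dominating : Graph n → Subset n → Set
Dominating G D = ∀ w → ∃[ u ] u ∈ D × (G N[ u ]) w

-- In a position, D and S are the sets of vertices claimed by Dominator and
-- Staller.  An element of DominatorWins is a winning strategy tree for
-- Dominator from that position with the given player to move.  If every
-- vertex is claimed and D does not dominate, neither constructor applies:
-- Dominator has lost, hence the premise ∃ Unclaimed in staller-moves.

data Player : Set where
  dominator staller : Player

Unclaimed : Subset n → Subset n → Pred (Fin n) 0ℓ
Unclaimed D S v = v ∉ D × v ∉ S

data DominatorWins (G : Graph n) : Player → Subset n → Subset n → Set where
  dominated       : ∀ {p D S} → Dominating G D → DominatorWins G p D S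
  dominator-moves : ∀ {D S} v → Unclaimed D S v →
                    DominatorWins G staller (D ∪ ⁅ v ⁆) S →
                    DominatorWins G dominator D S
  staller-moves   : ∀ {D S} → ∃ (Unclaimed D S) →
                    (∀ v → Unclaimed D S v → DominatorWins G dominator D (S ∪ ⁅ v ⁆)) →
                    DominatorWins G staller D S

Outcome𝓓 : Graph n → Set
Outcome𝓓 G = ∀ first → DominatorWins G first ⊥ ⊥

-- The vertex v : Fin n is v_{toℕ v + 1} in one-based numbering.

EvenOrEvenNonCutVertex : Graph n → Set
EvenOrEvenNonCutVertex {n} G =
  2 ∣ n ⊎ (∃[ v ] 2 ∣ suc (toℕ v) × ¬ CutVertex G v)

{-# OPTIONS --safe #-}
-- Unit intervals sorted by left endpoint satisfy the umbrella property: if p ≤ u < v ≤ q and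
-- p, q are adjacent, so are u, v.  Hence in a connected graph consecutive vertices are adjacent,
-- and an inner vertex is a cut-vertex exactly when its two neighbours in the order are not
-- adjacent.
--  * the least vertex of each factor component, paired with another vertex of the component,
--    yields a pairing dominating set;
--  * Dominator wins by always answering in the pair Staller has just played in;
--  * counting from 0, if n is odd and no edge joins 2i to 2i+2, the neighbours of every even
--    vertex are consecutive to it, so Staller plays 1, 3, 5, …, each move forcing the reply
--    0, 2, 4, …, until the last vertex n-1 can no longer be defended;
--  * otherwise the vertices split into consecutive pairs, plus the triangle 2i, 2i+1, 2i+2
--    when n is odd.
module Submission where

open import Level using (0ℓ)
open import Data.Nat using (ℕ; zero; suc; _+_; _*_; _∸_; _≤_; _<_; _<?_; z≤n; s≤s; s≤s⁻¹)
import Data.Nat.Properties as ℕ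
open import Data.Nat.Divisibility
  using (_∣_; _∣?_; divides; ∣-refl; ∣1⇒≡1; ∣m∣n⇒∣m+n; ∣m+n∣m⇒∣n)
open import Data.Fin as Fin using (Fin; toℕ; fromℕ<; zero; suc)
open import Data.Fin.Properties as Fin using (toℕ<n; toℕ-fromℕ<; toℕ-injective; any?; all?)
open import Data.Fin.Induction using (<-wellFounded)
open import Data.Fin.Subset using (Subset; _∈_; _∉_; _∪_; _⊃_; ⁅_⁆)
open import Data.Fin.Subset.Properties
  using (_∈?_; ∉⊥; x∈⁅x⁆; x∈⁅y⁆⇒x≡y; x∈p∪q⁻; x∈p∪q⁺)
open import Data.Fin.Subset.Induction using (Acc; acc; ⊃-wellFounded)
open import Data.Rational as ℚ using (0ℚ; 1ℚ; ½)
import Data.Rational.Properties as ℚ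
open import Data.Rational.Solver using (module +-*-Solver)
open import Data.List using (List; []; _∷_; map; filter; concatMap; allFin)
import Data.List.Membership.Propositional as List
open import Data.List.Membership.Propositional.Properties using (∈-allFin; ∈-filter⁺)
open import Data.List.Relation.Binary.Disjoint.Propositional using (Disjoint)
open import Data.List.Relation.Unary.All as All using (All; []; _∷_)
import Data.List.Relation.Unary.All.Properties as All
open import Data.List.Relation.Unary.Any as Any using (Any; here; there)
import Data.List.Relation.Unary.Any.Properties as Any
open import Data.List.Relation.Unary.AllPairs as AllPairs using (AllPairs; []; _∷_)
import Data.List.Relation.Unary.AllPairs.Properties as AllPairs
open import Data.List.Relation.Unary.Unique.Propositional using (Unique)
import Data.List.Relation.Unary.Unique.Propositional.Properties as Unique
open import Data.Product using (∃; ∃₂; ∃-syntax; _×_; _,_; proj₁; proj₂; map₂)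
open import Data.Product.Properties using (≡-dec)
open import Data.Sum as Sum using (_⊎_; inj₁; inj₂; [_,_]′)
open import Function using (_∘_; id; mk⇔)
open import Function.Bundles using (_⇔_; module Equivalence)
open import Relation.Binary.Core using (Rel)
open import Relation.Binary.Definitions using (tri<; tri≈; tri>)
open import Relation.Binary.Construct.Closure.ReflexiveTransitive
  using (Star; ε; _◅_; return; kleisliStar; reverse)
open import Relation.Binary.PropositionalEquality
  using (_≡_; _≢_; refl; sym; trans; cong; subst; subst₂; ≢-sym)
open import Relation.Nullary using (¬_; Dec; yes; no; ¬?; contradiction; decidable-stable;
  _×-dec_; _⊎-dec_; _→-dec_)
open import Relation.Unary as Unary using (Pred)
open import Defs
open Equivalence using (to; from)

private
  variable
    n : ℕ

-- Starting dates

≤ℝ-trans : ∀ x y z → x ≤ℝ y → y ≤ℝ z → x ≤ℝ z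
≤ℝ-trans x y z x≤y y≤z δ δ>0 = M + N , λ i M+N≤i → begin
  seq x i                         ≤⟨ x≤y′ i (ℕ.m+n≤o⇒m≤o M M+N≤i) ⟩
  seq y i ℚ.+ δ ℚ.* ½              ≤⟨ ℚ.+-monoˡ-≤ (δ ℚ.* ½) (y≤z′ i (ℕ.m+n≤o⇒n≤o M M+N≤i)) ⟩
  seq z i ℚ.+ δ ℚ.* ½ ℚ.+ δ ℚ.* ½   ≡⟨ halves (seq z i) δ ⟩
  seq z i ℚ.+ δ                   ∎
  where
  open ℝ
  open ℚ.≤-Reasoning
  halves : ∀ a b → a ℚ.+ b ℚ.* ½ ℚ.+ b ℚ.* ½ ≡ a ℚ.+ b
  halves = solve 2 (λ a b → a :+ b :* con ½ :+ b :* con ½ := a :+ b) refl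
    where open +-*-Solver
  δ/2>0 : 0ℚ ℚ.< δ ℚ.* ½
  δ/2>0 = ℚ.*-monoˡ-<-pos ½ δ>0
  M = proj₁ (x≤y (δ ℚ.* ½) δ/2>0)
  x≤y′ = proj₂ (x≤y (δ ℚ.* ½) δ/2>0)
  N = proj₁ (y≤z (δ ℚ.* ½) δ/2>0)
  y≤z′ = proj₂ (y≤z (δ ℚ.* ½) δ/2>0)

+ℚ-monoˡ-≤ℝ : ∀ x y q → x ≤ℝ y → x +ℚ q ≤ℝ y +ℚ q
+ℚ-monoˡ-≤ℝ x y q x≤y δ δ>0 = map₂ shift (x≤y δ δ>0)
  where
  open ℝ
  rearrange : ∀ a b c → a ℚ.+ b ℚ.+ c ≡ a ℚ.+ c ℚ.+ b
  rearrange = solve 3 (λ a b c → a :+ b :+ c := a :+ c :+ b) refl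
    where open +-*-Solver
  shift : ∀ {N} → (∀ i → N ≤ i → seq x i ℚ.≤ seq y i ℚ.+ δ) →
          ∀ i → N ≤ i → seq x i ℚ.+ q ℚ.≤ seq y i ℚ.+ q ℚ.+ δ
  shift close i N≤i = subst (seq x i ℚ.+ q ℚ.≤_) (rearrange (seq y i) δ q)
    (ℚ.+-monoˡ-≤ q (close i N≤i))

-- The umbrella property, the only form in which the representation enters the combinatorial parts.
-- `u < v` is strict because `Adj` is irreflexive.
IntervalOrdered : Graph n → Set
IntervalOrdered G = ∀ {p u v q} →
  toℕ p ≤ toℕ u → toℕ u < toℕ v → toℕ v ≤ toℕ q → Adj G p q → Adj G u v

-- A common point `t` of the two outer intervals lies in the interval of every `w` between them:
-- `start w ≤ start q ≤ t ≤ start p + 1 ≤ start w + 1`.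
representation⇒intervalOrdered :
  (G : Graph n) (start : Fin n → ℝ) → IsUnitIntervalRepresentation G start →
  IncreasingStartingDates start → IntervalOrdered G
representation⇒intervalOrdered G start rep mono {p} {u} {v} {q} p≤u u<v v≤q pq
  with to (rep p q λ { refl → ℕ.<⇒≱ u<v (ℕ.≤-trans v≤q p≤u) }) pq
... | t , (_ , t≤p+1) , (q≤t , _) =
  from (rep u v λ { refl → ℕ.<-irrefl refl u<v })
       (t , (meets u (ℕ.≤-trans u≤v v≤q) p≤u)
          , (meets v v≤q (ℕ.≤-trans p≤u u≤v)))
  where
  u≤v = ℕ.<⇒≤ u<v
  meets : ∀ w → toℕ w ≤ toℕ q → toℕ p ≤ toℕ w → t ∈[ start w ,+1]
  meets w w≤q p≤w =
    ≤ℝ-trans (start w) (start q) t (mono w q w≤q) q≤t ,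
    ≤ℝ-trans t (start p +ℚ 1ℚ) (start w +ℚ 1ℚ) t≤p+1
      (+ℚ-monoˡ-≤ℝ (start p) (start w) 1ℚ (mono p w p≤w))

-- Shortcuts

2∤1 : ¬ 2 ∣ 1
2∤1 2∣1 with () ← ∣1⇒≡1 2∣1

2∣⊎2∣suc : ∀ n → 2 ∣ n ⊎ 2 ∣ suc n
2∣⊎2∣suc zero    = inj₁ (divides 0 refl)
2∣⊎2∣suc (suc n) = [ inj₂ ∘ ∣m∣n⇒∣m+n ∣-refl , inj₁ ]′ (2∣⊎2∣suc n)

-- Applied to initial segments of the order: the edge leaving the segment jumps over its boundary,
-- where the umbrella property can use it.
crossing : ∀ {A : Set} {R : Rel A 0ℓ} {Q : Pred A 0ℓ} {x y} → Unary.Decidable Q →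
           Star R x y → Q x → ¬ Q y → ∃₂ λ p q → R p q × Q p × ¬ Q q
crossing Q? ε Qx ¬Qy = contradiction Qx ¬Qy
crossing Q? (_◅_ {j = z} xz zy) Qx ¬Qy with Q? z
... | yes Qz = crossing Q? zy Qz ¬Qy
... | no ¬Qz = _ , z , xz , Qx , ¬Qz

-- In one-based numbering, an edge from v_{2i-1} to v_{2i+1}.
EvenShortcut : Graph n → Set
EvenShortcut G = ∃₂ λ a b → 2 ∣ toℕ a × toℕ b ≡ 2 + toℕ a × Adj G a b

evenShortcut? : (G : Graph n) → Dec (EvenShortcut G)
evenShortcut? G = any? λ a → any? λ b →
  2 ∣? toℕ a ×-dec toℕ b ℕ.≟ 2 + toℕ a ×-dec adj? G a b

module _ (G : Graph n) (ordered : IntervalOrdered G) where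

  -- A walk from `u` to `v` must leave the initial segment ending at `u`; the edge on which it does
  -- so spans both vertices.
  consecutive-adjacent : Connected G → ∀ {u v} → toℕ v ≡ suc (toℕ u) → Adj G u v
  consecutive-adjacent connected {u} {v} v≡1+u
    with p , q , pq , p≤u , q≰u ←
      crossing (λ x → toℕ x ℕ.≤? toℕ u) (connected u v) ℕ.≤-refl
        (λ v≤u → ℕ.<⇒≱ (ℕ.≤-reflexive (sym v≡1+u)) v≤u)
    = ordered p≤u (ℕ.≤-reflexive (sym v≡1+u))
        (ℕ.≤-trans (ℕ.≤-reflexive v≡1+u) (ℕ.≰⇒> q≰u)) pq

  -- The edge that takes a walk from `a` to `b` out of the vertices below `v` cannot end in `v`
  -- itself, so it spans both `a` and `b`.
  connectedWithout⇒adjacent : ∀ {a v b} → toℕ a < toℕ v → toℕ v < toℕ b →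
    suc (toℕ a) ≡ toℕ v → suc (toℕ v) ≡ toℕ b → ConnectedWithout G v → Adj G a b
  connectedWithout⇒adjacent {a} {v} {b} a<v v<b a+1≡v v+1≡b connected
    with p , q , (pq , _ , q≢v) , p<v , q≮v ←
      crossing (λ x → toℕ x <? toℕ v)
        (connected a b (λ { refl → ℕ.<-irrefl refl a<v }) (λ { refl → ℕ.<-irrefl refl v<b }))
        a<v (ℕ.<-asym v<b)
    = ordered (s≤s⁻¹ (ℕ.≤-trans p<v (ℕ.≤-reflexive (sym a+1≡v)))) (ℕ.<-trans a<v v<b)
        (ℕ.≤-trans (ℕ.≤-reflexive (sym v+1≡b))
          (ℕ.≤∧≢⇒< (ℕ.≮⇒≥ q≮v) (λ v≡q → q≢v (toℕ-injective (sym v≡q)))))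
        pq

  evenNonCutVertex⇒evenShortcut : ¬ 2 ∣ n →
    (∃[ v ] 2 ∣ suc (toℕ v) × ¬ CutVertex G v) → EvenShortcut G
  evenNonCutVertex⇒evenShortcut 2∤n (v , 2∣1+v , ¬cut) with toℕ v in v≡
  ... | zero  = contradiction 2∣1+v 2∤1
  ... | suc k = a , b , subst (2 ∣_) (sym a≡) 2∣k , trans b≡ (cong (2 +_) (sym a≡)) ,
    -- `¬ CutVertex G v` is a double negation of connectedness; decidability of adjacency removes
    -- it.
    decidable-stable (adj? G a b) λ ¬ab → ¬cut λ connected →
      ¬ab (connectedWithout⇒adjacent
        (ℕ.≤-reflexive a+1≡v) (ℕ.≤-reflexive v+1≡b) a+1≡v v+1≡b connected)
    where
    2∣k : 2 ∣ k
    2∣k = ∣m+n∣m⇒∣n 2∣1+v ∣-refl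
    -- `2 + k` is even and `n` is odd, so `v` is not the last vertex and the successor `b` exists.
    2+k<n : 2 + k < n
    2+k<n = ℕ.≤∧≢⇒< (subst (_< n) v≡ (toℕ<n v)) λ { refl → 2∤n 2∣1+v }
    k<n : k < n
    k<n = ℕ.<-trans (ℕ.<-trans (ℕ.n<1+n k) (ℕ.n<1+n (suc k))) 2+k<n
    a = fromℕ< k<n
    b = fromℕ< 2+k<n
    a≡ : toℕ a ≡ k
    a≡ = toℕ-fromℕ< k<n
    b≡ : toℕ b ≡ 2 + k
    b≡ = toℕ-fromℕ< 2+k<n
    a+1≡v : suc (toℕ a) ≡ toℕ v
    a+1≡v = trans (cong suc a≡) (sym v≡)
    v+1≡b : suc (toℕ v) ≡ toℕ b
    v+1≡b = trans (cong suc v≡) (sym b≡)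

  -- Retracting v onto a maps every edge of G to a walk avoiding v.
  evenShortcut⇒evenNonCutVertex : Connected G → EvenShortcut G → ∃[ v ] 2 ∣ suc (toℕ v) × ¬ CutVertex G v
  evenShortcut⇒evenNonCutVertex connected (a , b , 2∣a , b≡2+a , ab) =
    v , subst (λ k → 2 ∣ suc k) (sym v≡1+a) (∣m∣n⇒∣m+n ∣-refl 2∣a) , λ cut → cut λ x y x≢v y≢v →
      subst₂ (Star Avoiding) (retract-fixes x≢v) (retract-fixes y≢v)
        (kleisliStar retract retract-edge (connected x y))
    where
    1+a<n : suc (toℕ a) < _
    1+a<n = ℕ.≤-trans (ℕ.≤-reflexive (sym b≡2+a)) (ℕ.<⇒≤ (toℕ<n b))
    v = fromℕ< 1+a<n
    v≡1+a : toℕ v ≡ suc (toℕ a)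
    v≡1+a = toℕ-fromℕ< 1+a<n
    a<v : toℕ a < toℕ v
    a<v = ℕ.≤-reflexive (sym v≡1+a)
    v<b : toℕ v < toℕ b
    v<b = ℕ.≤-reflexive (trans (cong suc v≡1+a) (sym b≡2+a))

    Avoiding : Rel (Fin _) _
    Avoiding x y = Adj G x y × x ≢ v × y ≢ v

    a≢v : a ≢ v
    a≢v a≡v = ℕ.<⇒≢ a<v (cong toℕ a≡v)
    b≢v : b ≢ v
    b≢v b≡v = ℕ.<⇒≢ v<b (cong toℕ (sym b≡v))

    -- From below `a`, the edge to `v` spans `a`. From beyond `b`, the edge to `v` spans `b`, and
    -- the shortcut leads on to `a`.
    walk-to-a : ∀ {x} → x ≢ v → Adj G x v → Star Avoiding x a
    walk-to-a {x} x≢v xv with ℕ.<-cmp (toℕ x) (toℕ a)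
    ... | tri< x<a _ _ = return (ordered ℕ.≤-refl x<a (ℕ.<⇒≤ a<v) xv , x≢v , a≢v)
    ... | tri≈ _ x≡a _ = subst (λ y → Star Avoiding y a) (sym (toℕ-injective x≡a)) ε
    ... | tri> _ _ a<x with x Fin.≟ b
    ...   | yes refl = return (symm G ab , b≢v , a≢v)
    ...   | no x≢b   =
      (symm G (ordered (ℕ.<⇒≤ v<b) b<x ℕ.≤-refl (symm G xv)) , x≢v , b≢v) ◅
      return (symm G ab , b≢v , a≢v)
      where
      v<x : toℕ v < toℕ x
      v<x = ℕ.≤∧≢⇒< (ℕ.≤-trans (ℕ.≤-reflexive v≡1+a) a<x) λ v≡x → x≢v (toℕ-injective (sym v≡x))
      b<x : toℕ b < toℕ x
      b<x = ℕ.≤∧≢⇒< (ℕ.≤-trans (ℕ.≤-reflexive (trans b≡2+a (cong suc (sym v≡1+a)))) v<x)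
              λ b≡x → x≢b (toℕ-injective (sym b≡x))

    retract : Fin _ → Fin _
    retract x with x Fin.≟ v
    ... | yes _ = a
    ... | no  _ = x

    retract-fixes : ∀ {x} → x ≢ v → retract x ≡ x
    retract-fixes {x} x≢v with x Fin.≟ v
    ... | yes x≡v = contradiction x≡v x≢v
    ... | no _    = refl

    retract-edge : ∀ {x y} → Adj G x y → Star Avoiding (retract x) (retract y)
    retract-edge {x} {y} xy with x Fin.≟ v | y Fin.≟ v
    ... | yes _    | yes _    = ε
    ... | yes refl | no y≢v   = reverse avoiding-sym (walk-to-a y≢v (symm G xy))
      where
      avoiding-sym : ∀ {x y} → Avoiding x y → Avoiding y x
      avoiding-sym (xy , x≢v , y≢v) = symm G xy , y≢v , x≢v
    ... | no x≢v   | yes refl = walk-to-a x≢v xy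
    ... | no x≢v   | no y≢v   = return (xy , x≢v , y≢v)

-- Factors

flatten : List (Fin n × Fin n) → List (Fin n)
flatten = concatMap (λ (u , v) → u ∷ v ∷ [])

-- Needed because distinct vertices have disjoint pairs only when both are leaders.
allPairs-relativize : ∀ {A : Set} {P : Pred A 0ℓ} {R S : Rel A 0ℓ} {xs : List A} →
  (∀ {x y} → P x → P y → R x y → S x y) → All P xs → AllPairs R xs → AllPairs S xs
allPairs-relativize f []         []         = []
allPairs-relativize f (px ∷ pxs) (rx ∷ rxs) =
  All.zipWith (λ (py , rxy) → f px py rxy) (pxs , rx) ∷ allPairs-relativize f pxs rxs

⟨K₂,K₃⟩-complete : ∀ {k F} → ⟨K₂,K₃⟩ (k , F) → ∀ {i j} → i ≢ j → Adj F i j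
⟨K₂,K₃⟩-complete (inj₁ refl) i≢j = i≢j
⟨K₂,K₃⟩-complete (inj₂ refl) i≢j = i≢j

⟨K₂,K₃⟩-neighbour : ∀ {k F} → ⟨K₂,K₃⟩ (k , F) → ∀ i → ∃ (Adj F i)
⟨K₂,K₃⟩-neighbour (inj₁ refl) zero    = suc zero , λ ()
⟨K₂,K₃⟩-neighbour (inj₁ refl) (suc i) = zero , λ ()
⟨K₂,K₃⟩-neighbour (inj₂ refl) zero    = suc zero , λ ()
⟨K₂,K₃⟩-neighbour (inj₂ refl) (suc i) = zero , λ ()

module _ {H : Graph n} where

  component-neighbour : ∀ {v k F} → ⟨K₂,K₃⟩ (k , F) → ComponentIso H v F → ∃ (Adj H v)
  component-neighbour {v} K iso =
    let open ComponentIso iso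
        i , i↦v = to (image v) ε
        j , ij  = ⟨K₂,K₃⟩-neighbour K i
    in embed j , subst (λ u → Adj H u (embed j)) i↦v (to (adjacency i j) ij)

  component-transitive : ∀ {x y z k F} → ⟨K₂,K₃⟩ (k , F) → ComponentIso H y F →
    Adj H x y → Adj H y z → x ≢ z → Adj H x z
  component-transitive {x} {z = z} K iso xy yz x≢z =
    let open ComponentIso iso
        i , i↦x = to (image x) (return (symm H xy))
        j , j↦z = to (image z) (return yz)
        i≢j = λ i≡j → x≢z (trans (sym i↦x) (trans (cong embed i≡j) j↦z))
    in subst₂ (Adj H) i↦x j↦z (to (adjacency i j) (⟨K₂,K₃⟩-complete K i≢j))

-- The two hypotheses make `H` a disjoint union of cliques, none of them a single vertex. Being
-- least among its neighbours therefore makes a leader least in its component.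
module Leaders (H : Graph n) (neighbour : ∀ v → ∃ (Adj H v))
    (transitive : ∀ {x y z} → Adj H x y → Adj H y z → x ≢ z → Adj H x z) where

  mate : Fin n → Fin n
  mate v = proj₁ (neighbour v)

  mate-adjacent : ∀ v → Adj H v (mate v)
  mate-adjacent v = proj₂ (neighbour v)

  Leader : Pred (Fin n) 0ℓ
  Leader v = ∀ u → Adj H v u → toℕ v < toℕ u

  leader? : Unary.Decidable Leader
  leader? v = all? λ u → adj? H v u →-dec toℕ v <? toℕ u

  leaders-nonadjacent : ∀ {v w} → Leader v → Leader w → ¬ Adj H v w
  leaders-nonadjacent v-leads w-leads vw = ℕ.<-asym (v-leads _ vw) (w-leads _ (symm H vw))

  -- Descent along smaller neighbours; transitivity shortens the way back from the leader to at most
  -- one edge.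
  leader-of : ∀ w → Acc Fin._<_ w → ∃[ v ] Leader v × (H N[ v ]) w
  leader-of w (acc smaller) with any? (λ u → adj? H w u ×-dec toℕ u <? toℕ w)
  ... | no none = w , leads , inj₁ refl
    where
    leads : Leader w
    leads u wu = ℕ.≤∧≢⇒< (ℕ.≮⇒≥ λ u<w → none (u , wu , u<w))
      λ w≡u → irrefl H (toℕ-injective w≡u) wu
  ... | yes (u , wu , u<w) with leader-of u (smaller u<w)
  ...   | v , v-leads , inj₁ refl = v , v-leads , inj₂ (symm H wu)
  ...   | v , v-leads , inj₂ vu with w Fin.≟ v
  ...     | yes w≡v = v , v-leads , inj₁ w≡v
  ...     | no  w≢v = v , v-leads , inj₂ (transitive vu (symm H wu) (≢-sym w≢v))

  leaders : List (Fin n)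
  leaders = filter leader? (allFin n)

  leader-pair : Fin n → Fin n × Fin n
  leader-pair v = v , mate v

  -- A common member would make the two leaders equal or adjacent, the latter by transitivity if it
  -- is the mate of both.
  leader-pairs-disjoint : ∀ {v w} → Leader v → Leader w → v ≢ w →
    Disjoint (v ∷ mate v ∷ []) (w ∷ mate w ∷ [])
  leader-pairs-disjoint {v} {w} v-leads w-leads v≢w = λ where
    (here refl , here v≡w) → v≢w v≡w
    (here refl , there (here refl)) →
      leaders-nonadjacent w-leads v-leads (mate-adjacent w)
    (there (here refl) , here refl) →
      leaders-nonadjacent v-leads w-leads (mate-adjacent v)
    (there (here refl) , there (here v′≡w′)) →
      leaders-nonadjacent v-leads w-leads
        (transitive (mate-adjacent v)
          (subst (λ x → Adj H x w) (sym v′≡w′) (symm H (mate-adjacent w))) v≢w)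

  leader-pairs-unique : Unique (flatten (map leader-pair leaders))
  leader-pairs-unique = Unique.concat⁺
    (All.map⁺ (All.map⁺ (All.universal
      (λ v → ((λ v≡v′ → irrefl H v≡v′ (mate-adjacent v)) ∷ []) ∷ [] ∷ []) leaders)))
    (AllPairs.map⁺ (AllPairs.map⁺
      (allPairs-relativize leader-pairs-disjoint (All.all-filter leader? (allFin n))
        (Unique.filter⁺ leader? (Unique.allFin⁺ n)))))

  -- All vertices of a clique component have the same closed neighbourhood.
  leader-pair-dominates : ∀ {v w} → (H N[ v ]) w → (H N[ mate v ]) w
  leader-pair-dominates {v} (inj₁ refl) = inj₂ (symm H (mate-adjacent v))
  leader-pair-dominates {v} {w} (inj₂ vw) with w Fin.≟ mate v
  ... | yes w≡v′ = inj₁ w≡v′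
  ... | no  w≢v′ = inj₂ (transitive (symm H (mate-adjacent v)) vw (≢-sym w≢v′))

factor⇒pairingDominatingSet : {G : Graph n} → HasFactor ⟨K₂,K₃⟩ G → HasPairingDominatingSet G
factor⇒pairingDominatingSet {n} {G} record { factor = H ; subgraph = H⊆G ; components = component } =
  map leader-pair leaders ,
  leader-pairs-unique ,
  λ w → let v , v-leads , w∈N[v] = leader-of w (<-wellFounded w) in
    Any.map⁺ (Any.map
      (λ { refl → Sum.map₂ (H⊆G _ _) w∈N[v] ,
                  Sum.map₂ (H⊆G _ _) (leader-pair-dominates w∈N[v]) })
      (∈-filter⁺ leader? (∈-allFin v) v-leads))
  where
  neighbour : ∀ v → ∃ (Adj H v)
  neighbour v = let _ , _ , K , iso = component v in component-neighbour K iso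
  transitive : ∀ {x y z} → Adj H x y → Adj H y z → x ≢ z → Adj H x z
  transitive {y = y} = let _ , _ , K , iso = component y in component-transitive K iso
  open Leaders H neighbour transitive

-- Pairings

-- Unordered, since Staller may play at either end of a listed pair.
Matches : Fin n → Fin n → Pred (Fin n × Fin n) 0ℓ
Matches a b (u , v) = (a ≡ u × b ≡ v) ⊎ (a ≡ v × b ≡ u)

Partner : List (Fin n × Fin n) → Rel (Fin n) 0ℓ
Partner pairs a b = Any (Matches a b) pairs

partner? : ∀ pairs (a b : Fin n) → Dec (Partner pairs a b)
partner? pairs a b = Any.any? (λ (u , v) →
  (a Fin.≟ u ×-dec b Fin.≟ v) ⊎-dec (a Fin.≟ v ×-dec b Fin.≟ u)) pairs

partner-sym : ∀ {pairs} {a b : Fin n} → Partner pairs a b → Partner pairs b a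
partner-sym = Any.map λ where
  (inj₁ (a≡u , b≡v)) → inj₂ (b≡v , a≡u)
  (inj₂ (a≡v , b≡u)) → inj₁ (b≡u , a≡v)

partner-∈ : ∀ {pairs} {a b : Fin n} → Partner pairs a b → a List.∈ flatten pairs
partner-∈ (here (inj₁ (a≡u , _))) = here a≡u
partner-∈ (here (inj₂ (a≡v , _))) = there (here a≡v)
partner-∈ (there ab)              = there (there (partner-∈ ab))

partner-irrefl : ∀ {pairs} → Unique (flatten pairs) → {a : Fin n} → ¬ Partner pairs a a
partner-irrefl ((u≢v ∷ _) ∷ _) (here (inj₁ (refl , a≡v))) = u≢v a≡v
partner-irrefl ((u≢v ∷ _) ∷ _) (here (inj₂ (refl , a≡u))) = u≢v (sym a≡u)
partner-irrefl (_ ∷ _ ∷ distinct) (there aa) = partner-irrefl distinct aa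

unpartnered-tail : ∀ {p pairs} → Unique (flatten (p ∷ pairs)) →
  {a b c : Fin n} → Matches a b p → ¬ Partner pairs a c
unpartnered-tail ((_ ∷ u∉) ∷ _) (inj₁ (refl , _)) ac = All.lookup u∉ (partner-∈ ac) refl
unpartnered-tail (_ ∷ v∉ ∷ _)   (inj₂ (refl , _)) ac = All.lookup v∉ (partner-∈ ac) refl

partner-functional : ∀ {pairs} → Unique (flatten pairs) →
  {a b c : Fin n} → Partner pairs a b → Partner pairs a c → b ≡ c
partner-functional _ (here (inj₁ (refl , refl))) (here (inj₁ (_ , refl))) = refl
partner-functional _ (here (inj₂ (refl , refl))) (here (inj₂ (_ , refl))) = refl
partner-functional ((u≢v ∷ _) ∷ _) (here (inj₁ (refl , _))) (here (inj₂ (u≡v , _))) =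
  contradiction u≡v u≢v
partner-functional ((u≢v ∷ _) ∷ _) (here (inj₂ (refl , _))) (here (inj₁ (v≡u , _))) =
  contradiction (sym v≡u) u≢v
partner-functional distinct (here ab) (there ac) = contradiction ac (unpartnered-tail distinct ab)
partner-functional distinct (there ab) (here ac) = contradiction ab (unpartnered-tail distinct ac)
partner-functional (_ ∷ _ ∷ distinct) (there ab) (there ac) = partner-functional distinct ab ac

-- Claiming vertices

unclaimed? : ∀ (D S : Subset n) → Unary.Decidable (Unclaimed D S)
unclaimed? D S v = ¬? (v ∈? D) ×-dec ¬? (v ∈? S)

∈-claim⁻ : ∀ {D : Subset n} {v x} → x ∈ D ∪ ⁅ v ⁆ → x ∈ D ⊎ x ≡ v
∈-claim⁻ {D = D} {v} = Sum.map₂ (x∈⁅y⁆⇒x≡y v) ∘ x∈p∪q⁻ D ⁅ v ⁆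

∈-claimed : ∀ {D : Subset n} v → v ∈ D ∪ ⁅ v ⁆
∈-claimed v = x∈p∪q⁺ (inj₂ (x∈⁅x⁆ v))

∈-claim⁺ : ∀ {D : Subset n} {v x} → x ∈ D → x ∈ D ∪ ⁅ v ⁆
∈-claim⁺ = x∈p∪q⁺ ∘ inj₁

module _ {D S : Subset n} {v : Fin n} where

  -- Together with `staller-claim-⊃`, the termination measure of the game: the set of claimed
  -- vertices grows strictly.
  dominator-claim-⊃ : Unclaimed D S v → ((D ∪ ⁅ v ⁆) ∪ S) ⊃ (D ∪ S)
  dominator-claim-⊃ (v∉D , v∉S) =
    (x∈p∪q⁺ ∘ Sum.map₁ ∈-claim⁺ ∘ x∈p∪q⁻ D S) ,
    v , x∈p∪q⁺ (inj₁ (∈-claimed v)) , [ v∉D , v∉S ]′ ∘ x∈p∪q⁻ D S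

  staller-claim-⊃ : Unclaimed D S v → (D ∪ (S ∪ ⁅ v ⁆)) ⊃ (D ∪ S)
  staller-claim-⊃ (v∉D , v∉S) =
    (x∈p∪q⁺ ∘ Sum.map₂ ∈-claim⁺ ∘ x∈p∪q⁻ D S) ,
    v , x∈p∪q⁺ (inj₂ (∈-claimed v)) , [ v∉D , v∉S ]′ ∘ x∈p∪q⁻ D S

-- Dominator's pairing strategy

module PairingStrategy (G : Graph n) (pairs : List (Fin n × Fin n))
    (distinct : Unique (flatten pairs))
    (covers : ∀ w → Any (λ (u , v) → (G N[ u ]) w × (G N[ v ]) w) pairs) where

  -- The invariant of the strategy. It is monotone in `D`, so a surplus move of Dominator never
  -- breaks it.
  Answered : Rel (Subset n) 0ℓ
  Answered D S = ∀ {a b} → Partner pairs a b → a ∈ S → b ∈ D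

  answered-claim : ∀ {D S v} → Answered D S → Answered (D ∪ ⁅ v ⁆) S
  answered-claim answered ab a∈S = ∈-claim⁺ (answered ab a∈S)

  -- On a full board Dominator holds an end of every pair, and either end dominates whatever the
  -- pair covers.
  full-board-dominated : ∀ {D S} → Answered D S → ¬ ∃ (Unclaimed D S) → Dominating G D
  full-board-dominated {D} {S} answered full w
    with (u , v) , uv∈pairs , w∈N[u] , w∈N[v] ← List.find (covers w)
    with u ∈? D
  ... | yes u∈D = u , u∈D , w∈N[u]
  ... | no  u∉D = v , answered (Any.map (λ { refl → inj₁ (refl , refl) }) uv∈pairs) u∈S , w∈N[v]
    where
    u∈S : u ∈ S
    u∈S = decidable-stable (u ∈? S) λ u∉S → full (u , u∉D , u∉S)

  dominator-to-move : ∀ {D S} → Acc _⊃_ (D ∪ S) → Answered D S → DominatorWins G dominator D S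
  staller-to-move : ∀ {D S} → Acc _⊃_ (D ∪ S) → Answered D S → DominatorWins G staller D S

  dominator-to-move {D} {S} (acc larger) answered with any? (unclaimed? D S)
  ... | no full = dominated (full-board-dominated answered full)
  -- No answer is due here, so any free vertex will do.
  ... | yes (v , free) =
    dominator-moves v free (staller-to-move (larger (dominator-claim-⊃ free)) (answered-claim answered))

  staller-to-move {D} {S} (acc larger) answered with any? (unclaimed? D S)
  ... | no full = dominated (full-board-dominated answered full)
  ... | yes free = staller-moves free reply
    where
    reply : ∀ v → Unclaimed D S v → DominatorWins G dominator D (S ∪ ⁅ v ⁆)
    reply v v-free@(v∉D , v∉S) with any? (λ b → partner? pairs v b ×-dec ¬? (b ∈? D))
    ... | no none = dominator-to-move (larger (staller-claim-⊃ v-free)) still-answered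
      where
      still-answered : Answered D (S ∪ ⁅ v ⁆)
      still-answered {a} {b} ab a∈S∪v with ∈-claim⁻ a∈S∪v
      ... | inj₁ a∈S  = answered ab a∈S
      ... | inj₂ refl = decidable-stable (b ∈? D) λ b∉D → none (b , ab , b∉D)
    -- The round claims two vertices, so accessibility is unfolded twice.
    ... | yes (b , vb , b∉D) with larger (staller-claim-⊃ v-free)
    ...   | acc larger′ =
      dominator-moves b b-free (staller-to-move (larger′ (dominator-claim-⊃ b-free)) answered′)
      where
      -- Had Staller claimed `b` earlier, the invariant would have given `v` to Dominator already.
      b-free : Unclaimed D (S ∪ ⁅ v ⁆) b
      b-free = b∉D , λ b∈S∪v → case-b (∈-claim⁻ b∈S∪v)
        where
        case-b : b ∈ S ⊎ b ≡ v → _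
        case-b (inj₁ b∈S)  = v∉D (answered (partner-sym vb) b∈S)
        case-b (inj₂ refl) = partner-irrefl distinct vb
      answered′ : Answered (D ∪ ⁅ b ⁆) (S ∪ ⁅ v ⁆)
      answered′ ac a∈S∪v with ∈-claim⁻ a∈S∪v
      ... | inj₁ a∈S = ∈-claim⁺ (answered ac a∈S)
      ... | inj₂ refl rewrite partner-functional distinct ac vb = ∈-claimed b

pairingDominatingSet⇒outcome𝓓 : {G : Graph n} → HasPairingDominatingSet G → Outcome𝓓 G
pairingDominatingSet⇒outcome𝓓 {G = G} (pairs , distinct , covers) =
  let open PairingStrategy G pairs distinct covers in λ where
  dominator → dominator-to-move (⊃-wellFounded _) λ _ a∈⊥ → contradiction a∈⊥ ∉⊥
  staller   → staller-to-move (⊃-wellFounded _) λ _ a∈⊥ → contradiction a∈⊥ ∉⊥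

-- Staller's strategy

-- `DominatorWins` also accepts overlapping sets; legal play from the empty board never produces
-- them.
Separate : Rel (Subset n) 0ℓ
Separate D S = ∀ {x} → x ∈ S → x ∉ D

module _ {D S : Subset n} {v : Fin n} where

  separate-dominator-claim : Separate D S → Unclaimed D S v → Separate (D ∪ ⁅ v ⁆) S
  separate-dominator-claim separate (_ , v∉S) x∈S =
    [ separate x∈S , (λ { refl → v∉S x∈S }) ]′ ∘ ∈-claim⁻

  separate-staller-claim : Separate D S → Unclaimed D S v → Separate D (S ∪ ⁅ v ⁆)
  separate-staller-claim separate (v∉D , _) x∈S∪v x∈D =
    [ (λ x∈S → separate x∈S x∈D) , (λ { refl → v∉D x∈D }) ]′ (∈-claim⁻ x∈S∪v)

module _ {G : Graph n} {w : Fin n} where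

  -- Claims are never undone, so induction on the strategy tree refutes it. At Staller's turn the
  -- free vertex stored in `staller-moves` selects a branch to follow.
  closed-neighbourhood-claimed : ∀ {p D S} → (∀ {u} → (G N[ u ]) w → u ∈ S) →
    Separate D S → ¬ DominatorWins G p D S
  closed-neighbourhood-claimed N⊆S separate (dominated dominates)
    with u , u∈D , w∈N[u] ← dominates w = separate (N⊆S w∈N[u]) u∈D
  closed-neighbourhood-claimed N⊆S separate (dominator-moves v free wins) =
    closed-neighbourhood-claimed N⊆S (separate-dominator-claim separate free) wins
  closed-neighbourhood-claimed N⊆S separate (staller-moves (v , free) wins) =
    closed-neighbourhood-claimed (∈-claim⁺ ∘ N⊆S) (separate-staller-claim separate free) (wins v free)

  -- Staller completes the closed neighbourhood by claiming `w` herself.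
  neighbourhood-claimed : ∀ {D S} → Unclaimed D S w → (∀ {u} → Adj G w u → u ∈ S) →
    Separate D S → ¬ DominatorWins G staller D S
  neighbourhood-claimed (w∉D , _) N⊆S separate (dominated dominates) with dominates w
  ... | _ , w∈D , inj₁ refl = w∉D w∈D
  ... | _ , u∈D , inj₂ uw   = separate (N⊆S (symm G uw)) u∈D
  neighbourhood-claimed free N⊆S separate (staller-moves _ wins) =
    closed-neighbourhood-claimed
      (λ { (inj₁ refl) → ∈-claimed w ; (inj₂ uw) → ∈-claim⁺ (N⊆S (symm G uw)) })
      (separate-staller-claim separate free) (wins w free)

module StallerStrategy (G : Graph n) (ordered : IntervalOrdered G)
    (2∤n : ¬ 2 ∣ n) (no-shortcut : ¬ EvenShortcut G) where

  -- An edge from `e` to a vertex two or more places away spans, by the umbrella property, a pair at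
  -- distance two with `e` as one end. Both ends are even, so this is a forbidden shortcut.
  even-neighbours-consecutive : ∀ {e x} → 2 ∣ toℕ e → Adj G e x →
    toℕ x ≡ suc (toℕ e) ⊎ suc (toℕ x) ≡ toℕ e
  even-neighbours-consecutive {e} {x} 2∣e ex with ℕ.<-cmp (toℕ x) (toℕ e)
  ... | tri≈ _ x≡e _ = contradiction ex (irrefl G (sym (toℕ-injective x≡e)))
  ... | tri> _ _ e<x = inj₁ (sym (decidable-stable (suc (toℕ e) ℕ.≟ toℕ x) λ 1+e≢x →
    let 2+e≤x = ℕ.≤∧≢⇒< e<x 1+e≢x
        y     = fromℕ< (ℕ.≤-<-trans 2+e≤x (toℕ<n x))
        y≡2+e = toℕ-fromℕ< (ℕ.≤-<-trans 2+e≤x (toℕ<n x))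
    in no-shortcut (e , y , 2∣e , y≡2+e ,
         ordered ℕ.≤-refl (ℕ.≤-trans (ℕ.n≤1+n _) (ℕ.≤-reflexive (sym y≡2+e)))
           (ℕ.≤-trans (ℕ.≤-reflexive y≡2+e) 2+e≤x) ex)))
  ... | tri< x<e _ _ = inj₂ (decidable-stable (suc (toℕ x) ℕ.≟ toℕ e) λ 1+x≢e →
    let 2+x≤e = ℕ.≤∧≢⇒< x<e 1+x≢e
        k     = toℕ e ∸ 2
        2+k≡e = ℕ.m+[n∸m]≡n (ℕ.≤-trans (s≤s (s≤s z≤n)) 2+x≤e)
        k<e   = ℕ.≤-trans (ℕ.n≤1+n _) (ℕ.≤-reflexive 2+k≡e)
        k<n   = ℕ.<-trans k<e (toℕ<n e)
        y     = fromℕ< k<n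
        y≡k   = toℕ-fromℕ< k<n
        x≤k   = ℕ.+-cancelˡ-≤ 2 _ _ (ℕ.≤-trans 2+x≤e (ℕ.≤-reflexive (sym 2+k≡e)))
        2∣k   = ∣m+n∣m⇒∣n (subst (2 ∣_) (sym 2+k≡e) 2∣e) ∣-refl
    in no-shortcut (y , e , subst (2 ∣_) (sym y≡k) 2∣k , trans (sym 2+k≡e) (cong (2 +_) (sym y≡k)) ,
         ordered (ℕ.≤-trans x≤k (ℕ.≤-reflexive (sym y≡k))) (ℕ.≤-<-trans (ℕ.≤-reflexive y≡k) k<e)
           ℕ.≤-refl (symm G ex)))

  -- The invariant at Staller's turn: play has not yet reached `e`, and the past matters only
  -- through the predecessor of `e`. At vertex 0 that condition is vacuous, so the empty board
  -- qualifies.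
  record Frontier (e : Fin n) (D S : Subset n) : Set where
    field
      even        : 2 ∣ toℕ e
      free        : ∀ {x} → toℕ e ≤ toℕ x → Unclaimed D S x
      predecessor : ∀ {x} → suc (toℕ x) ≡ toℕ e → x ∈ S
      separate    : Separate D S
  open Frontier

  -- `e` itself is undominated: its only possible neighbours are its predecessor, held by Staller,
  -- and its successor, still free.
  frontier-undominated : ∀ {e D S} → Frontier e D S → ¬ Dominating G D
  frontier-undominated {e} F dominates with dominates e
  ... | _ , e∈D , inj₁ refl = proj₁ (free F ℕ.≤-refl) e∈D
  ... | u , u∈D , inj₂ ue with even-neighbours-consecutive (even F) (symm G ue)
  ...   | inj₁ u≡1+e = proj₁ (free F (ℕ.≤-trans (ℕ.n≤1+n _) (ℕ.≤-reflexive (sym u≡1+e)))) u∈D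
  ...   | inj₂ 1+u≡e = separate F (predecessor F 1+u≡e) u∈D

  -- Staller claims the successor o of e, which forces Dominator to answer at e;
  -- at the last vertex Staller claims e itself.
  frontier-lost : ∀ {e D S} → Frontier e D S → ¬ DominatorWins G staller D S
  forced-reply-lost : ∀ {e o D S} → Frontier e D S → toℕ o ≡ suc (toℕ e) →
    ¬ DominatorWins G dominator D (S ∪ ⁅ o ⁆)

  frontier-lost F (dominated dominates) = frontier-undominated F dominates
  frontier-lost {e} F wins@(staller-moves _ reply) with suc (toℕ e) <? n
  ... | yes 1+e<n =
    forced-reply-lost F (toℕ-fromℕ< 1+e<n) (reply (fromℕ< 1+e<n) (free F
      (ℕ.≤-trans (ℕ.n≤1+n _) (ℕ.≤-reflexive (sym (toℕ-fromℕ< 1+e<n))))))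
  ... | no 1+e≮n =
    neighbourhood-claimed (free F ℕ.≤-refl)
      (λ {u} eu → [ (λ u≡1+e → contradiction (subst (_< n) u≡1+e (toℕ<n u)) 1+e≮n) , predecessor F ]′
        (even-neighbours-consecutive (even F) eu))
      (separate F) wins

  forced-reply-lost F _ (dominated dominates) = frontier-undominated F dominates
  forced-reply-lost {e} {o} {D} {S} F o≡1+e (dominator-moves v v-free wins) with v Fin.≟ e
  -- Dominator ignores the threat: every neighbour of `e` is now Staller's and `e` is free for her
  -- to take.
  ... | no v≢e =
    neighbourhood-claimed
      ( [ proj₁ (free F ℕ.≤-refl) , v≢e ∘ sym ]′ ∘ ∈-claim⁻
      , [ proj₂ (free F ℕ.≤-refl) , (λ { refl → ℕ.1+n≢n (sym o≡1+e) }) ]′ ∘ ∈-claim⁻ )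
      (λ eu → [ (λ u≡1+e → subst (_∈ S ∪ ⁅ o ⁆) (toℕ-injective (trans o≡1+e (sym u≡1+e))) (∈-claimed o))
              , ∈-claim⁺ ∘ predecessor F ]′ (even-neighbours-consecutive (even F) eu))
      (separate-dominator-claim (separate-staller-claim (separate F) o-free) v-free) wins
    where
    o-free = free F (ℕ.≤-trans (ℕ.n≤1+n _) (ℕ.≤-reflexive (sym o≡1+e)))
  ... | yes refl = frontier-lost next wins
    where
    o-free = free F (ℕ.≤-trans (ℕ.n≤1+n _) (ℕ.≤-reflexive (sym o≡1+e)))
    2∣2+e : 2 ∣ 2 + toℕ e
    2∣2+e = ∣m∣n⇒∣m+n ∣-refl (even F)
    -- Oddness of `n` keeps the chain going: `o` cannot be last, since `2 + toℕ e` is even.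
    2+e<n : 2 + toℕ e < n
    2+e<n = ℕ.≤∧≢⇒< (subst (_< n) o≡1+e (toℕ<n o)) λ { 2+e≡n → 2∤n (subst (2 ∣_) 2+e≡n 2∣2+e) }
    e′≡2+e : toℕ (fromℕ< 2+e<n) ≡ 2 + toℕ e
    e′≡2+e = toℕ-fromℕ< 2+e<n
    next : Frontier (fromℕ< 2+e<n) (D ∪ ⁅ e ⁆) (S ∪ ⁅ o ⁆)
    next .even = subst (2 ∣_) (sym e′≡2+e) 2∣2+e
    next .free {x} e′≤x =
      ( [ proj₁ x-free , (λ { refl → ℕ.1+n≰n (ℕ.<⇒≤ 2+e≤x) }) ]′ ∘ ∈-claim⁻
      , [ proj₂ x-free , (λ { refl → ℕ.1+n≰n (ℕ.≤-trans 2+e≤x (ℕ.≤-reflexive o≡1+e)) }) ]′ ∘ ∈-claim⁻ )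
      where
      2+e≤x : 2 + toℕ e ≤ toℕ x
      2+e≤x = ℕ.≤-trans (ℕ.≤-reflexive (sym e′≡2+e)) e′≤x
      x-free = free F (ℕ.<⇒≤ (ℕ.<⇒≤ 2+e≤x))
    next .predecessor {x} 1+x≡e′ =
      subst (_∈ S ∪ ⁅ o ⁆)
        (toℕ-injective (trans o≡1+e (sym (ℕ.suc-injective (trans 1+x≡e′ e′≡2+e))))) (∈-claimed o)
    next .separate = separate-dominator-claim (separate-staller-claim (separate F) o-free) v-free

outcome𝓓⇒evenShortcut : (G : Graph n) → IntervalOrdered G → ¬ 2 ∣ n → Outcome𝓓 G → EvenShortcut G
outcome𝓓⇒evenShortcut {zero}  G ordered 2∤0 _ = contradiction (divides 0 refl) 2∤0
outcome𝓓⇒evenShortcut {suc _} G ordered 2∤n outcome =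
  decidable-stable (evenShortcut? G) λ no-shortcut →
    let open StallerStrategy G ordered 2∤n no-shortcut in
    frontier-lost {zero} record
      { even = divides 0 refl
      ; free = λ _ → ∉⊥ , ∉⊥
      ; predecessor = λ ()
      ; separate = λ x∈⊥ _ → ∉⊥ x∈⊥
      } (outcome staller)

-- Tilings

-- The interval from `s` up to but excluding `k + s`. The edge between its extreme vertices is
-- enough, as the umbrella property then makes it a clique.
record Block (G : Graph n) (s k : ℕ) : Set where
  field
    size       : k ≡ 2 ⊎ k ≡ 3
    first last : Fin n
    first≡     : toℕ first ≡ s
    last≡      : suc (toℕ last) ≡ k + s
    joined     : Adj G first last

data Tiling (G : Graph n) : ℕ → Set where
  done : Tiling G n
  tile : ∀ {s k} → Block G s k → Tiling G (k + s) → Tiling G s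

tiling-≤ : ∀ {G : Graph n} {s} → Tiling G s → s ≤ n
tiling-≤ done               = ℕ.≤-refl
tiling-≤ (tile {s} {k} _ T) = ℕ.≤-trans (ℕ.m≤n+m s k) (tiling-≤ T)

-- The pair (start, size); junk for x outside [s, n).
blockOf : ∀ {G : Graph n} {s} → Tiling G s → ℕ → ℕ × ℕ
blockOf done               x = 0 , 0
blockOf (tile {s} {k} _ T) x with x <? k + s
... | yes _ = s , k
... | no  _ = blockOf T x

blockStart blockSize : ∀ {G : Graph n} {s} → Tiling G s → ℕ → ℕ
blockStart T x = proj₁ (blockOf T x)
blockSize T x = proj₂ (blockOf T x)

blockOf-block : ∀ {G : Graph n} {s x} (T : Tiling G s) → s ≤ x → x < n →
  Block G (blockStart T x) (blockSize T x) ×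
  s ≤ blockStart T x × blockStart T x ≤ x × x < blockSize T x + blockStart T x
blockOf-block done n≤x x<n = contradiction n≤x (ℕ.<⇒≱ x<n)
blockOf-block {x = x} (tile {s} {k} B T) s≤x x<n with x <? k + s
... | yes x<k+s = B , ℕ.≤-refl , s≤x , x<k+s
... | no  x≮k+s with blockOf-block T (ℕ.≮⇒≥ x≮k+s) x<n
...   | B′ , k+s≤t , inside = B′ , ℕ.≤-trans (ℕ.m≤n+m s k) k+s≤t , inside

-- Blocks are disjoint intervals: `x` and `y` on different sides of a cut `k + s` cannot share one.
blockOf-unique : ∀ {G : Graph n} {s x y} (T : Tiling G s) → s ≤ x → x < n →
  blockStart T x ≤ y → y < blockSize T x + blockStart T x → blockOf T y ≡ blockOf T x
blockOf-unique done n≤x x<n = contradiction n≤x (ℕ.<⇒≱ x<n)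
blockOf-unique {x = x} {y} (tile {s} {k} B T) s≤x x<n t≤y y<end with x <? k + s | y <? k + s
... | yes _     | yes _     = refl
... | yes _     | no  y≮k+s = contradiction y<end y≮k+s
... | no  x≮k+s | no  _     = blockOf-unique T (ℕ.≮⇒≥ x≮k+s) x<n t≤y y<end
... | no  x≮k+s | yes y<k+s =
  contradiction (ℕ.≤-trans (proj₁ (proj₂ (blockOf-block T (ℕ.≮⇒≥ x≮k+s) x<n))) t≤y) (ℕ.<⇒≱ y<k+s)

-- From a tiling to a factor

module TilingFactor (G : Graph n) (ordered : IntervalOrdered G) (T : Tiling G 0) where

  blockOfVertex : Fin n → ℕ × ℕ
  blockOfVertex u = blockOf T (toℕ u)

  start size : Fin n → ℕ
  start u = blockStart T (toℕ u)
  size  u = blockSize T (toℕ u)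

  block : ∀ u → Block G (start u) (size u)
  block u = proj₁ (blockOf-block T z≤n (toℕ<n u))

  start≤ : ∀ u → start u ≤ toℕ u
  start≤ u = proj₁ (proj₂ (proj₂ (blockOf-block T z≤n (toℕ<n u))))

  <end : ∀ u → toℕ u < size u + start u
  <end u = proj₂ (proj₂ (proj₂ (blockOf-block T z≤n (toℕ<n u))))

  -- As an equality of descriptors this is a decidable equivalence at once, and `subst` carries
  -- block bounds from one vertex to another.
  SameBlock : Rel (Fin n) 0ℓ
  SameBlock u v = blockOfVertex u ≡ blockOfVertex v

  factorGraph : Graph n
  factorGraph .Adj u v = u ≢ v × SameBlock u v
  factorGraph .irrefl u≡v (u≢v , _) = u≢v u≡v
  factorGraph .symm (u≢v , u~v) = ≢-sym u≢v , sym u~v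
  factorGraph .adj? u v = ¬? (u Fin.≟ v) ×-dec ≡-dec ℕ._≟_ ℕ._≟_ (blockOfVertex u) (blockOfVertex v)

  sameBlock-< : ∀ {u v} → toℕ u < toℕ v → SameBlock u v → Adj G u v
  sameBlock-< {u} {v} u<v u~v = ordered
    (ℕ.≤-trans (ℕ.≤-reflexive first≡) (start≤ u)) u<v
    (s≤s⁻¹ (ℕ.≤-trans (subst (λ (t , k) → toℕ v < k + t) (sym u~v) (<end v))
                      (ℕ.≤-reflexive (sym last≡))))
    joined
    where open Block (block u)

  factorGraph-⊆ : ∀ u v → Adj factorGraph u v → Adj G u v
  factorGraph-⊆ u v (u≢v , u~v) with ℕ.<-cmp (toℕ u) (toℕ v)
  ... | tri< u<v _ _ = sameBlock-< u<v u~v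
  ... | tri≈ _ u≡v _ = contradiction (toℕ-injective u≡v) u≢v
  ... | tri> _ _ v<u = symm G (sameBlock-< v<u (sym u~v))

  reachable⇒sameBlock : ∀ {u v} → Reachable factorGraph u v → SameBlock u v
  reachable⇒sameBlock ε                 = refl
  reachable⇒sameBlock ((_ , u~w) ◅ w⋯v) = trans u~w (reachable⇒sameBlock w⋯v)

  sameBlock⇒reachable : ∀ {u v} → SameBlock u v → Reachable factorGraph u v
  sameBlock⇒reachable {u} {v} u~v with u Fin.≟ v
  ... | yes refl = ε
  ... | no  u≢v  = return (u≢v , u~v)

  module _ (v : Fin n) where

    position< : (i : Fin (size v)) → toℕ i + start v < n
    position< i = ℕ.<-≤-trans (ℕ.+-monoˡ-< (start v) (toℕ<n i))
      (ℕ.≤-trans (ℕ.≤-reflexive (sym last≡)) (toℕ<n last))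
      where open Block (block v)

    position : Fin (size v) → Fin n
    position i = fromℕ< (position< i)

    position-toℕ : ∀ i → toℕ (position i) ≡ toℕ i + start v
    position-toℕ i = toℕ-fromℕ< (position< i)

    position-injective : ∀ {i j} → position i ≡ position j → i ≡ j
    position-injective {i} {j} eq = toℕ-injective (ℕ.+-cancelʳ-≡ (start v) _ _
      (trans (sym (position-toℕ i)) (trans (cong toℕ eq) (position-toℕ j))))

    position-sameBlock : ∀ i → SameBlock (position i) v
    position-sameBlock i = blockOf-unique T z≤n (toℕ<n v)
      (ℕ.≤-trans (ℕ.m≤n+m (start v) (toℕ i)) (ℕ.≤-reflexive (sym (position-toℕ i))))
      (ℕ.≤-<-trans (ℕ.≤-reflexive (position-toℕ i)) (ℕ.+-monoˡ-< (start v) (toℕ<n i)))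

    position-surjective : ∀ {u} → SameBlock v u → ∃[ i ] position i ≡ u
    position-surjective {u} v~u = fromℕ< offset< , toℕ-injective
      (trans (position-toℕ _) (trans (cong (_+ start v) (toℕ-fromℕ< offset<)) (ℕ.m∸n+n≡m t≤u)))
      where
      t≤u : start v ≤ toℕ u
      t≤u = subst (λ (t , k) → t ≤ toℕ u) (sym v~u) (start≤ u)
      u<end : toℕ u < size v + start v
      u<end = subst (λ (t , k) → toℕ u < k + t) (sym v~u) (<end u)
      offset< : toℕ u ∸ start v < size v
      offset< = ℕ.+-cancelʳ-< (start v) _ _ (ℕ.≤-<-trans (ℕ.≤-reflexive (ℕ.m∸n+n≡m t≤u)) u<end)

    componentIso : ComponentIso factorGraph v (K (size v))
    componentIso = record
      { embed     = position
      ; injective = position-injective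
      ; image     = λ u → mk⇔ (position-surjective ∘ reachable⇒sameBlock)
          λ { (i , refl) → sameBlock⇒reachable (sym (position-sameBlock i)) }
      ; adjacency = λ i j → mk⇔
          (λ i≢j → i≢j ∘ position-injective , trans (position-sameBlock i) (sym (position-sameBlock j)))
          λ { (pi≢pj , _) i≡j → pi≢pj (cong position i≡j) }
      }

  factor : HasFactor ⟨K₂,K₃⟩ G
  factor = record
    { factor     = factorGraph
    ; subgraph   = factorGraph-⊆
    ; components = λ v → size v , K (size v) ,
        Sum.map (cong λ k → k , K k) (cong λ k → k , K k) (Block.size (block v)) , componentIso v
    }

-- Tilings from parity and a shortcut

module _ (G : Graph n) (consecutive : ∀ {u v} → toℕ v ≡ suc (toℕ u) → Adj G u v) where

  prepend-pairs : ∀ q {s} → Tiling G (q * 2 + s) → Tiling G s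
  prepend-pairs zero        T = T
  prepend-pairs (suc q) {s} T = tile pair rest
    where
    rest : Tiling G (2 + s)
    rest = prepend-pairs q (subst (Tiling G) eq T)
      where
      eq : suc q * 2 + s ≡ q * 2 + (2 + s)
      eq = trans (cong (_+ s) (ℕ.+-comm 2 (q * 2))) (ℕ.+-assoc (q * 2) 2 s)
    -- `tiling-≤ rest` says `2 + s ≤ n`, so both vertices `s` and `1 + s` of the pair exist.
    s<n : s < n
    s<n = ℕ.<⇒≤ (tiling-≤ rest)
    pair : Block G s 2
    pair = record
      { size = inj₁ refl
      ; first = fromℕ< s<n ; last = fromℕ< (tiling-≤ rest)
      ; first≡ = toℕ-fromℕ< s<n ; last≡ = cong suc (toℕ-fromℕ< (tiling-≤ rest))
      ; joined = consecutive (trans (toℕ-fromℕ< (tiling-≤ rest)) (cong suc (sym (toℕ-fromℕ< s<n))))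
      }

  pairs-to : ∀ {s t} → s ≤ t → 2 ∣ t ∸ s → Tiling G t → Tiling G s
  pairs-to {s} {t} s≤t (divides q t∸s≡q*2) T =
    prepend-pairs q (subst (Tiling G) (trans (sym (ℕ.m∸n+n≡m s≤t)) (cong (_+ s) t∸s≡q*2)) T)

  even-tiling : 2 ∣ n → Tiling G 0
  even-tiling 2∣n = pairs-to z≤n 2∣n done

  odd-tiling : ¬ 2 ∣ n → EvenShortcut G → Tiling G 0
  odd-tiling 2∤n (a , b , 2∣a , b≡2+a , ab) =
    pairs-to z≤n 2∣a (tile triangle (pairs-to 3+a≤n 2∣n∸[3+a] done))
    where
    triangle : Block G (toℕ a) 3
    triangle = record
      { size = inj₂ refl ; first = a ; last = b
      ; first≡ = refl ; last≡ = cong suc b≡2+a ; joined = ab }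
    3+a≤n : 3 + toℕ a ≤ n
    3+a≤n = subst (_< n) b≡2+a (toℕ<n b)
    2∣1+n : 2 ∣ 1 + n
    2∣1+n = [ (λ 2∣n → contradiction 2∣n 2∤n) , id ]′ (2∣⊎2∣suc n)
    -- Obtained by subtracting `4 + toℕ a` from `1 + n`: the shift by one makes both numbers even.
    2∣n∸[3+a] : 2 ∣ n ∸ (3 + toℕ a)
    2∣n∸[3+a] = ∣m+n∣m⇒∣n (subst (2 ∣_) (cong suc (sym (ℕ.m+[n∸m]≡n 3+a≤n))) 2∣1+n)
      (∣m∣n⇒∣m+n (divides 2 refl) 2∣a)

theorem4p5 : ∀ (n : ℕ) → 2 ≤ n → (G : Graph n) → Connected G →
    (start : Fin n → ℝ) →
    IsUnitIntervalRepresentation G start →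
    IncreasingStartingDates start →
    (Outcome𝓓 G ⇔ HasFactor ⟨K₂,K₃⟩ G)
    × (HasFactor ⟨K₂,K₃⟩ G ⇔ HasPairingDominatingSet G)
    × (HasPairingDominatingSet G ⇔ EvenOrEvenNonCutVertex G)
theorem4p5 n _ G connected start representation increasing =
  -- Everything is composed from the cycle `1⇒4`, `4⇒2`, `2⇒3`, `3⇒1`.
  mk⇔ (4⇒2 ∘ 1⇒4) (3⇒1 ∘ 2⇒3) , mk⇔ 2⇒3 (4⇒2 ∘ 1⇒4 ∘ 3⇒1) , mk⇔ (1⇒4 ∘ 3⇒1) (2⇒3 ∘ 4⇒2)
  where
  ordered : IntervalOrdered G
  ordered = representation⇒intervalOrdered G start representation increasing

  consecutive : ∀ {u v} → toℕ v ≡ suc (toℕ u) → Adj G u v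
  consecutive = consecutive-adjacent G ordered connected

  1⇒4 : Outcome𝓓 G → EvenOrEvenNonCutVertex G
  1⇒4 outcome with 2 ∣? n
  ... | yes 2∣n = inj₁ 2∣n
  ... | no  2∤n = inj₂ (evenShortcut⇒evenNonCutVertex G ordered connected
    (outcome𝓓⇒evenShortcut G ordered 2∤n outcome))

  4⇒2 : EvenOrEvenNonCutVertex G → HasFactor ⟨K₂,K₃⟩ G
  4⇒2 condition with 2 ∣? n
  ... | yes 2∣n = TilingFactor.factor G ordered (even-tiling G consecutive 2∣n)
  ... | no  2∤n = TilingFactor.factor G ordered (odd-tiling G consecutive 2∤n
    ([ (λ 2∣n → contradiction 2∣n 2∤n) , evenNonCutVertex⇒evenShortcut G ordered 2∤n ]′ condition))

  2⇒3 : HasFactor ⟨K₂,K₃⟩ G → HasPairingDominatingSet G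
  2⇒3 = factor⇒pairingDominatingSet

  3⇒1 : HasPairingDominatingSet G → Outcome𝓓 G
  3⇒1 = pairingDominatingSet⇒outcome𝓓
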